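{- Let $(X,\le,\ast)$ be a semiframe and $F\subseteq X$ a semifilter. Then $F$ is regular if and only if $F$ is weakly regular and strongly compatible.
   Context: A semiframe is a triple $(X,\le,\ast)$ where $(X,\le)$ is a complete join-semilattice ($\bot_X=\bigvee\varnothing$) and $\ast$ is a compatibility relation: commutative; $x\ast x$ for every $x\neq\bot_X$; and $x\ast\bigvee Y$ iff $x\ast y$ for some $y\in Y$. A semifilter is a nonempty, up-closed subset $F$ with $y\ast y'$ for all $y,y'\in F$ (compatible). For $F\subseteq X$ write $x\ast F$ when $x\ast y$ for all $y\in F$, and $F^\ast=\{x\in X\mid x\ast F\}$. $F$ is strongly compatible when $F^\ast$ is nonempty and compatible. An element $x$ is transitive when $x\neq\bot_X$ and $x'\ast x\ast x''$ implies $x'\ast x''$. The abstract community of $F$ is $\mathcal K(F)=\bigvee\{z\in X\mid \neg(z\ast c_F)\}$ where $c_F=\bigvee\{y\in X\mid \neg(y\ast F)\}$ (equivalently $\mathcal K(F)=\bigvee\{x\in X\mid x^\ast\subseteq F^\ast\}$ with $x^\ast=\{x'\mid x'\ast x\}$). $F$ is weakly regular when $\mathcal K(F)\in F$, and regular when $\mathcal K(F)\in F$ and $\mathcal K(F)$ is transitive. -}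

module Defs where

open import Level using (Level; suc)
open import Data.Product.Base using (∃; _×_)
open import Function.Bundles using (_⇔_)
open import Relation.Binary.Bundles using (Poset)
open import Relation.Binary.Core using (Rel)
open import Relation.Binary.Definitions using (Symmetric; _Respects₂_)
open import Relation.Nullary.Negation.Core using (¬_)
open import Relation.Unary using (Pred; _∈_; Satisfiable)
open import Relation.Unary.Polymorphic using (∅)

-- Carrier, relations and subsets share one level ℓ, so that every subset
-- formed below by quantifying over the carrier again has a join.
-- The partial order is antisymmetric up to the setoid equality _≈_ of Poset;
-- taking _≈_ to be _≡_ gives the usual notion.

record CompleteJoinSemilattice (ℓ : Level) : Set (suc ℓ) where
  field
    poset : Poset ℓ ℓ ℓ
  open Poset poset public
  field
    ⋁       : Pred Carrier ℓ → Carrier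
    ⋁-upper : ∀ (Y : Pred Carrier ℓ) {y} → y ∈ Y → y ≤ ⋁ Y
    ⋁-least : ∀ (Y : Pred Carrier ℓ) {z} → (∀ {y} → y ∈ Y → y ≤ z) → ⋁ Y ≤ z

  ⊥ : Carrier
  ⊥ = ⋁ ∅

record Semiframe (ℓ : Level) : Set (suc ℓ) where
  infix 4 _∗_
  field
    completeJoinSemilattice : CompleteJoinSemilattice ℓ
  open CompleteJoinSemilattice completeJoinSemilattice public
  field
    _∗_       : Rel Carrier ℓ
    -- Automatic when _≈_ is _≡_.
    ∗-resp-≈  : _∗_ Respects₂ _≈_
    ∗-comm    : Symmetric _∗_
    ∗-refl    : ∀ {x} → ¬ (x ≈ ⊥) → x ∗ x
    ∗-distrib : ∀ x (Y : Pred Carrier ℓ) →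
                x ∗ ⋁ Y ⇔ ∃ λ y → y ∈ Y × x ∗ y

module _ {ℓ : Level} (S : Semiframe ℓ) where
  open Semiframe S

  Compatible : Pred Carrier ℓ → Set ℓ
  Compatible F = ∀ {y y′} → y ∈ F → y′ ∈ F → y ∗ y′

  UpClosed : Pred Carrier ℓ → Set ℓ
  UpClosed F = ∀ {x y} → x ∈ F → x ≤ y → y ∈ F

  record IsSemifilter (F : Pred Carrier ℓ) : Set ℓ where
    field
      nonempty   : Satisfiable F
      upClosed   : UpClosed F
      compatible : Compatible F

  -- The set F^∗; membership x ∈ star F is also the relation x ∗ F.
  star : Pred Carrier ℓ → Pred Carrier ℓ
  star F x = ∀ y → y ∈ F → x ∗ y

  StronglyCompatible : Pred Carrier ℓ → Set ℓ
  StronglyCompatible F = Satisfiable (star F) × Compatible (star F)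

  Transitive : Pred Carrier ℓ
  Transitive x = ¬ (x ≈ ⊥) × (∀ x′ x″ → x′ ∗ x → x ∗ x″ → x′ ∗ x″)

  -- c_F
  complementJoin : Pred Carrier ℓ → Carrier
  complementJoin F = ⋁ (λ y → ¬ (y ∈ star F))

  -- K(F)
  community : Pred Carrier ℓ → Carrier
  community F = ⋁ (λ z → ¬ (z ∗ complementJoin F))

  WeaklyRegular : Pred Carrier ℓ → Set ℓ
  WeaklyRegular F = community F ∈ F

  Regular : Pred Carrier ℓ → Set ℓ
  Regular F = community F ∈ F × Transitive (community F)

{-# OPTIONS --safe #-}

-- Nothing below c_F is compatible with K(F), so x ∗ K(F) implies x ∗ F; when
-- K(F) ∈ F the converse is immediate, and K(F) has the same compatible elements
-- as F. Transitivity of K(F) then says exactly that F^∗ is compatible.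
-- The classical step x ∗ F ∨ ¬ (x ∗ F) needs no extra axiom: a semiframe with a
-- self-compatible element already proves excluded middle, because ∗-refl turns
-- a negative fact (x is not ⊥) into a positive one.

module Submission where

open import Defs
open import Level using (Level)
open import Axiom.ExcludedMiddle using (ExcludedMiddle)
open import Data.Product.Base using (_×_; _,_; proj₁)
open import Function.Bundles using (_⇔_; mk⇔; module Equivalence)
open import Relation.Nullary.Decidable using (Dec; decidable-stable; ¬¬-excluded-middle)
open import Relation.Nullary.Negation using (¬_)
open import Relation.Unary using (Pred; _∈_)

module _ {ℓ : Level} (S : Semiframe ℓ) where
  open Semiframe S
  open Equivalence using (to; from)

  -- `z` is the join of its own down-set, which contains `y`, so `∗-distrib` carries compatibility
  -- from `y` to `z`.
  ∗-monoʳ-≤ : ∀ {x y z} → y ≤ z → x ∗ y → x ∗ z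
  ∗-monoʳ-≤ {x} {y} {z} y≤z x∗y =
    proj₁ ∗-resp-≈ (antisym (⋁-least (_≤ z) (λ w≤z → w≤z)) (⋁-upper (_≤ z) refl))
      (from (∗-distrib x (_≤ z)) (y , y≤z , x∗y))

  ¬∗⊥ : ∀ {x} → ¬ (x ∗ ⊥)
  ¬∗⊥ {x} x∗⊥ with to (∗-distrib x _) x∗⊥
  ... | _ , () , _

  ∗-self⇒≉⊥ : ∀ {x} → x ∗ x → ¬ (x ≈ ⊥)
  ∗-self⇒≉⊥ x∗x x≈⊥ = ¬∗⊥ (∗-monoʳ-≤ (reflexive x≈⊥) x∗x)

  -- The join of {y | P ∨ ¬ P} is not ⊥, hence compatible with itself, and
  -- ∗-distrib then exhibits a member of that set.
  ∗-self⇒excludedMiddle : ∀ {a} → a ∗ a → ExcludedMiddle ℓ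
  ∗-self⇒excludedMiddle {a} a∗a {P}
    with to (∗-distrib (⋁ Y) Y) (∗-refl ⋁Y≉⊥)
    where
    Y : Pred Carrier ℓ
    Y _ = Dec P

    ⋁Y≉⊥ : ¬ (⋁ Y ≈ ⊥)
    ⋁Y≉⊥ ⋁Y≈⊥ = ¬¬-excluded-middle λ P? →
      ¬∗⊥ (∗-monoʳ-≤ (trans (⋁-upper Y P?) (reflexive ⋁Y≈⊥)) a∗a)
  ... | _ , P? , _ = P?

  module _ (F : Pred Carrier ℓ) where

    ¬complementJoin∗community : ¬ (complementJoin S F ∗ community S F)
    ¬complementJoin∗community c∗K with to (∗-distrib _ _) c∗K
    ... | _ , ¬z∗c , c∗z = ¬z∗c (∗-comm c∗z)

    ∗-community⇒star : ExcludedMiddle ℓ → ∀ {x} → x ∗ community S F → x ∈ star S F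
    ∗-community⇒star em x∗K = decidable-stable em λ x∉F* →
      -- Being outside `star S F`, `x` is one of the elements joined into `complementJoin S F`, so
      -- it lies below it.
      ¬complementJoin∗community
        (∗-comm (∗-monoʳ-≤ (⋁-upper _ x∉F*) (∗-comm x∗K)))

    module _ (isSemifilter : IsSemifilter S F) where
      open IsSemifilter isSemifilter

      excludedMiddle : ExcludedMiddle ℓ
      excludedMiddle =
        let _ , a∈F = nonempty in ∗-self⇒excludedMiddle (compatible a∈F a∈F)

      regular⇒stronglyCompatible : Regular S F → StronglyCompatible S F
      regular⇒stronglyCompatible (K∈F , _ , K-trans) =
        -- Compatibility of `F` puts `F` inside `star S F`, so `community S F` is a witness.
        (community S F , λ _ → compatible K∈F) ,
        λ x∈F* x′∈F* → K-trans _ _ (x∈F* _ K∈F) (∗-comm (x′∈F* _ K∈F))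

      stronglyCompatible⇒transitive :
        WeaklyRegular S F → StronglyCompatible S F → Transitive S (community S F)
      stronglyCompatible⇒transitive K∈F (_ , F*-compatible) =
        ∗-self⇒≉⊥ (compatible K∈F K∈F) ,
        λ _ _ x′∗K K∗x″ → F*-compatible
          (∗-community⇒star excludedMiddle x′∗K)
          (∗-community⇒star excludedMiddle (∗-comm K∗x″))

theorem9p29 : ∀ {ℓ : Level} (S : Semiframe ℓ) (F : Pred (Semiframe.Carrier S) ℓ) →
    IsSemifilter S F →
    Regular S F ⇔ (WeaklyRegular S F × StronglyCompatible S F)
theorem9p29 S F isSemifilter = mk⇔
  (λ { regular@(K∈F , _) → K∈F , regular⇒stronglyCompatible S F isSemifilter regular })
  (λ { (K∈F , sc) → K∈F , stronglyCompatible⇒transitive S F isSemifilter K∈F sc })
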